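{- The category $\mathbf{SiLlStGrphs}$ satisfies none of the axioms (L1), (L2), (L3), (L4), (L5), (L6).
   Context: A (conceptual) graph $G$ consists of a set $P(G)$ of parts, a distinguished subset $V(G)\subseteq P(G)$ of vertices, and an incidence map $\partial_G:P(G)\to V(G)\underline{\times}V(G)$ into the set of unordered pairs of vertices (the pair of $u,v$ written $u\_v$; $u=v$ allowed), such that $\partial_G(v)=v\_v$ for every vertex $v$. The edges are $E(G)=P(G)\setminus V(G)$; an edge with incidence $u\_u$ is a loop. Sets may be infinite; the empty graph is allowed. A graph is simple if for every unordered pair $u\_v$ there is at most one edge with that incidence, and loopless if it has no loops. A strict graph morphism $f:G\to H$ is a function $f:P(G)\to P(H)$ with $f(V(G))\subseteq V(H)$ and $f(E(G))\subseteq E(H)$ such that $\partial_H(f(e))=f(x)\_f(y)$ whenever $\partial_G(e)=x\_y$. $\mathbf{SiLlStGrphs}$ is the category whose objects are the simple loopless graphs and whose morphisms are the strict graph morphisms between them. The axioms, for a category $\mathcal{C}$: (L1) $\mathcal{C}$ has all finite limits and all finite colimits. (L2) $\mathcal{C}$ has a terminal object, binary products, and for all objects $A,B$ an object $B^A$ with $ev:B^A\times A\to B$ such that for every $X$ and $g:X\times A\to B$ there is a unique $\bar g:X\to B^A$ with $ev\circ(\bar g\times 1_A)=g$. (L3) $\mathcal{C}$ has a subobject classifier: a terminal object $\hat 1$ and $\top:\hat1\to\Omega$ such that for every monomorphism $m:S\to X$ there is a unique $\chi:X\to\Omega$ with $m$ a pullback of $\top$ along $\chi$. (L4) $\mathcal{C}$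 has a natural number object: $\hat1$, $N$, $0:\hat1\to N$, $\sigma:N\to N$ such that for all $X$, $x:\hat1\to X$, $f:X\to X$ there is a unique $h:N\to X$ with $h0=x$, $h\sigma=fh$. (L5) For every morphism $f:A\to B$ with $A$ not initial there is $g:B\to A$ with $fgf=f$. (L6) $\mathcal{C}$ has a subobject classifier $\top:\hat1\to\Omega$ with $\Omega\cong\hat1+\hat1$. -}

module Defs where

open import Level using (Level; _⊔_) renaming (suc to lsuc; zero to lzero)
open import Data.Product using (Σ; _×_; _,_; proj₁; proj₂)
open import Data.Sum using (_⊎_; inj₁; inj₂)
open import Relation.Nullary using (¬_)
open import Relation.Binary.PropositionalEquality
  using (_≡_; refl; sym; trans; cong)

record Category (o ℓ e : Level) : Set (lsuc (o ⊔ ℓ ⊔ e)) where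
  infixr 9 _∘_
  infix  4 _≈_
  field
    Obj  : Set o
    Hom  : Obj → Obj → Set ℓ
    _≈_  : ∀ {A B} → Hom A B → Hom A B → Set e
    id   : ∀ {A} → Hom A A
    _∘_  : ∀ {A B C} → Hom B C → Hom A B → Hom A C
    ≈-refl  : ∀ {A B} {f : Hom A B} → f ≈ f
    ≈-sym   : ∀ {A B} {f g : Hom A B} → f ≈ g → g ≈ f
    ≈-trans : ∀ {A B} {f g h : Hom A B} → f ≈ g → g ≈ h → f ≈ h
    ∘-resp-≈ : ∀ {A B C} {f f' : Hom B C} {g g' : Hom A B} →
               f ≈ f' → g ≈ g' → f ∘ g ≈ f' ∘ g'
    assoc    : ∀ {A B C D} {f : Hom C D} {g : Hom B C} {h : Hom A B} →
               (f ∘ g) ∘ h ≈ f ∘ (g ∘ h)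
    identityˡ : ∀ {A B} {f : Hom A B} → id ∘ f ≈ f
    identityʳ : ∀ {A B} {f : Hom A B} → f ∘ id ≈ f

module Axioms {o ℓ e : Level} (𝒞 : Category o ℓ e) where
  open Category 𝒞

  ∃!Hom : ∀ {A B} → (Hom A B → Set e) → Set (ℓ ⊔ e)
  ∃!Hom {A} {B} P = Σ (Hom A B) λ h → P h × (∀ h' → P h' → h' ≈ h)

  IsTerminal : Obj → Set (o ⊔ ℓ ⊔ e)
  IsTerminal T = ∀ X → Σ (Hom X T) λ f → ∀ (g : Hom X T) → g ≈ f

  IsInitial : Obj → Set (o ⊔ ℓ ⊔ e)
  IsInitial I = ∀ X → Σ (Hom I X) λ f → ∀ (g : Hom I X) → g ≈ f

  HasTerminal : Set (o ⊔ ℓ ⊔ e)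
  HasTerminal = Σ Obj IsTerminal

  HasInitial : Set (o ⊔ ℓ ⊔ e)
  HasInitial = Σ Obj IsInitial

  IsProduct : ∀ {A B P} → Hom P A → Hom P B → Set (o ⊔ ℓ ⊔ e)
  IsProduct {A} {B} {P} π₁ π₂ =
    ∀ X (f : Hom X A) (g : Hom X B) →
      ∃!Hom {X} {P} λ h → (π₁ ∘ h ≈ f) × (π₂ ∘ h ≈ g)

  record Product (A B : Obj) : Set (o ⊔ ℓ ⊔ e) where
    field
      obj : Obj
      π₁  : Hom obj A
      π₂  : Hom obj B
      isProduct : IsProduct π₁ π₂
    ⟨_,_⟩ : ∀ {X} → Hom X A → Hom X B → Hom X obj
    ⟨ f , g ⟩ = proj₁ (isProduct _ f g)

  IsCoproduct : ∀ {A B Q} → Hom A Q → Hom B Q → Set (o ⊔ ℓ ⊔ e)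
  IsCoproduct {A} {B} {Q} ι₁ ι₂ =
    ∀ X (f : Hom A X) (g : Hom B X) →
      ∃!Hom {Q} {X} λ h → (h ∘ ι₁ ≈ f) × (h ∘ ι₂ ≈ g)

  record Coproduct (A B : Obj) : Set (o ⊔ ℓ ⊔ e) where
    field
      obj : Obj
      ι₁  : Hom A obj
      ι₂  : Hom B obj
      isCoproduct : IsCoproduct ι₁ ι₂

  IsEqualizer : ∀ {E A B} → Hom E A → Hom A B → Hom A B → Set (o ⊔ ℓ ⊔ e)
  IsEqualizer {E} {A} {B} m f g =
    (f ∘ m ≈ g ∘ m) ×
    (∀ X (k : Hom X A) → f ∘ k ≈ g ∘ k → ∃!Hom {X} {E} λ u → m ∘ u ≈ k)

  IsCoequalizer : ∀ {A B Q} → Hom B Q → Hom A B → Hom A B → Set (o ⊔ ℓ ⊔ e)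
  IsCoequalizer {A} {B} {Q} q f g =
    (q ∘ f ≈ q ∘ g) ×
    (∀ X (k : Hom B X) → k ∘ f ≈ k ∘ g → ∃!Hom {Q} {X} λ u → u ∘ q ≈ k)

  IsPullback : ∀ {A B C P} → Hom A C → Hom B C → Hom P A → Hom P B →
               Set (o ⊔ ℓ ⊔ e)
  IsPullback {A} {B} {C} {P} f g p₁ p₂ =
    (f ∘ p₁ ≈ g ∘ p₂) ×
    (∀ Z (a : Hom Z A) (b : Hom Z B) → f ∘ a ≈ g ∘ b →
       ∃!Hom {Z} {P} λ u → (p₁ ∘ u ≈ a) × (p₂ ∘ u ≈ b))

  IsMono : ∀ {A B} → Hom A B → Set (o ⊔ ℓ ⊔ e)
  IsMono {A} {B} m = ∀ X (g h : Hom X A) → m ∘ g ≈ m ∘ h → g ≈ h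

  _≅_ : Obj → Obj → Set (ℓ ⊔ e)
  A ≅ B = Σ (Hom A B) λ f → Σ (Hom B A) λ g → (g ∘ f ≈ id) × (f ∘ g ≈ id)

  HasBinaryProducts : Set (o ⊔ ℓ ⊔ e)
  HasBinaryProducts = ∀ A B → Product A B

  HasBinaryCoproducts : Set (o ⊔ ℓ ⊔ e)
  HasBinaryCoproducts = ∀ A B → Coproduct A B

  HasEqualizers : Set (o ⊔ ℓ ⊔ e)
  HasEqualizers = ∀ {A B} (f g : Hom A B) →
    Σ Obj λ E → Σ (Hom E A) λ m → IsEqualizer m f g

  HasCoequalizers : Set (o ⊔ ℓ ⊔ e)
  HasCoequalizers = ∀ {A B} (f g : Hom A B) →
    Σ Obj λ Q → Σ (Hom B Q) λ q → IsCoequalizer q f g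

  -- (L1) all finite limits and all finite colimits
  -- (finite limits = terminal object + binary products + equalizers; dually)
  L1 : Set (o ⊔ ℓ ⊔ e)
  L1 = (HasTerminal × HasBinaryProducts × HasEqualizers) ×
       (HasInitial × HasBinaryCoproducts × HasCoequalizers)

  HasExponentials : HasBinaryProducts → Set (o ⊔ ℓ ⊔ e)
  HasExponentials prod = ∀ A B →
    Σ Obj λ BA → Σ (Hom (Product.obj (prod BA A)) B) λ ev →
      ∀ X (g : Hom (Product.obj (prod X A)) B) →
        ∃!Hom {X} {BA} λ ḡ →
          let open Product (prod BA A) using (⟨_,_⟩)
              open Product (prod X A) using () renaming (π₁ to p₁; π₂ to p₂)
          in ev ∘ ⟨ ḡ ∘ p₁ , p₂ ⟩ ≈ g

  L2 : Set (o ⊔ ℓ ⊔ e)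
  L2 = HasTerminal × Σ HasBinaryProducts HasExponentials

  IsSubobjectClassifier : ∀ {T Ω} → IsTerminal T → Hom T Ω → Set (o ⊔ ℓ ⊔ e)
  IsSubobjectClassifier {T} {Ω} term ⊤ =
    ∀ {S X} (m : Hom S X) → IsMono m →
      Σ (Hom X Ω) λ χ → IsPullback χ ⊤ m (proj₁ (term S)) ×
        (∀ (χ' : Hom X Ω) → IsPullback χ' ⊤ m (proj₁ (term S)) → χ' ≈ χ)

  L3 : Set (o ⊔ ℓ ⊔ e)
  L3 = Σ Obj λ T → Σ (IsTerminal T) λ term → Σ Obj λ Ω →
         Σ (Hom T Ω) λ ⊤ → IsSubobjectClassifier term ⊤

  L4 : Set (o ⊔ ℓ ⊔ e)
  L4 = Σ Obj λ T → IsTerminal T × (Σ Obj λ N → Σ (Hom T N) λ z →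
         Σ (Hom N N) λ σ → ∀ X (x : Hom T X) (f : Hom X X) →
           ∃!Hom {N} {X} λ h → (h ∘ z ≈ x) × (h ∘ σ ≈ f ∘ h))

  L5 : Set (o ⊔ ℓ ⊔ e)
  L5 = ∀ {A B} (f : Hom A B) → ¬ IsInitial A →
         Σ (Hom B A) λ g → f ∘ g ∘ f ≈ f

  L6 : Set (o ⊔ ℓ ⊔ e)
  L6 = Σ Obj λ T → Σ (IsTerminal T) λ term → Σ Obj λ Ω →
         Σ (Hom T Ω) λ ⊤ → IsSubobjectClassifier term ⊤ ×
         (Σ (Coproduct T T) λ T+T → Ω ≅ Coproduct.obj T+T)

-- unordered pairs u_v, represented by ordered pairs up to swapping
UPair : Set → Set
UPair V = V × V

_≐_ : ∀ {V : Set} → UPair V → UPair V → Set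
(u , v) ≐ (x , y) = ((u ≡ x) × (v ≡ y)) ⊎ ((u ≡ y) × (v ≡ x))

record Graph : Set₁ where
  field
    Vtx  : Set
    Edg  : Set
    ends : Edg → UPair Vtx
  Parts : Set
  Parts = Vtx ⊎ Edg
  ∂ : Parts → UPair Vtx
  ∂ (inj₁ v) = (v , v)
  ∂ (inj₂ e) = ends e

open Graph

IsSimple : Graph → Set
IsSimple G = ∀ (e e' : Edg G) → ends G e ≐ ends G e' → e ≡ e'

IsLoopless : Graph → Set
IsLoopless G = ∀ (e : Edg G) → ¬ (proj₁ (ends G e) ≡ proj₂ (ends G e))

record SiLlGraph : Set₁ where
  field
    graph    : Graph
    simple   : IsSimple graph
    loopless : IsLoopless graph

-- strict graph morphisms: a map on parts sending vertices to vertices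
-- and edges to edges, i.e. a pair (fV , fE), preserving incidence
record StrictMorphism (G H : Graph) : Set where
  field
    fV : Vtx G → Vtx H
    fE : Edg G → Edg H
    incidence : ∀ (e : Edg G) →
      ends H (fE e) ≐ (fV (proj₁ (ends G e)) , fV (proj₂ (ends G e)))

open StrictMorphism

_≈ᴳ_ : ∀ {G H} → StrictMorphism G H → StrictMorphism G H → Set
f ≈ᴳ g = (∀ v → fV f v ≡ fV g v) × (∀ e → fE f e ≡ fE g e)

idᴳ : ∀ {G} → StrictMorphism G G
idᴳ {G} = record { fV = λ v → v ; fE = λ e → e
                 ; incidence = λ e → inj₁ (refl , refl) }

private
  ≐-map : ∀ {V W : Set} (h : V → W) {p q : UPair V} → p ≐ q →
          (h (proj₁ p) , h (proj₂ p)) ≐ (h (proj₁ q) , h (proj₂ q))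
  ≐-map h (inj₁ (a , b)) = inj₁ (cong h a , cong h b)
  ≐-map h (inj₂ (a , b)) = inj₂ (cong h a , cong h b)

  ≐-trans : ∀ {V : Set} {p q r : UPair V} → p ≐ q → q ≐ r → p ≐ r
  ≐-trans (inj₁ (a , b)) (inj₁ (c , d)) = inj₁ (trans a c , trans b d)
  ≐-trans (inj₁ (a , b)) (inj₂ (c , d)) = inj₂ (trans a c , trans b d)
  ≐-trans (inj₂ (a , b)) (inj₁ (c , d)) = inj₂ (trans a d , trans b c)
  ≐-trans (inj₂ (a , b)) (inj₂ (c , d)) = inj₁ (trans a d , trans b c)

_∘ᴳ_ : ∀ {G H K} → StrictMorphism H K → StrictMorphism G H → StrictMorphism G K
_∘ᴳ_ {G} {H} {K} f g = record
  { fV = λ v → fV f (fV g v)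
  ; fE = λ e → fE f (fE g e)
  ; incidence = λ e → ≐-trans (incidence f (fE g e))
                               (≐-map (fV f) (incidence g e)) }

SiLlStGrphs : Category (lsuc lzero) lzero lzero
SiLlStGrphs = record
  { Obj = SiLlGraph
  ; Hom = λ G H → StrictMorphism (SiLlGraph.graph G) (SiLlGraph.graph H)
  ; _≈_ = _≈ᴳ_
  ; id = idᴳ
  ; _∘_ = _∘ᴳ_
  ; ≈-refl = (λ _ → refl) , (λ _ → refl)
  ; ≈-sym = λ (p , q) → (λ v → sym (p v)) , (λ e → sym (q e))
  ; ≈-trans = λ (p , q) (p' , q') → (λ v → trans (p v) (p' v)) ,
                                     (λ e → trans (q e) (q' e))
  ; ∘-resp-≈ = λ {_} {_} {_} {f} {f'} {g} {g'} (p , q) (p' , q') →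
      (λ v → trans (cong (fV f) (p' v)) (p (fV g' v))) ,
      (λ e → trans (cong (fE f) (q' e)) (q (fE g' e)))
  ; assoc = (λ _ → refl) , (λ _ → refl)
  ; identityˡ = (λ _ → refl) , (λ _ → refl)
  ; identityʳ = (λ _ → refl) , (λ _ → refl)
  }

-- Strict morphisms send edges to edges and preserve incidence, so a morphism
-- identifying the two ends of an edge sends it to a loop. The swap of the
-- single-edge graph K₂ would be invisible to a terminal object T, so the unique
-- morphism K₂ → T would identify the ends of the edge: T cannot be loopless,
-- hence there is no terminal object, and (L1)–(L4), (L6) all demand one. For
-- (L5), a vertex K₁ → K₂ has no g : K₂ → K₁ at all, because K₁ has no edges,
-- while K₁ is not initial because nothing maps a vertex into the empty graph.
module Submission where

open import Defs
open import Data.Product using (_×_; _,_; proj₁; proj₂)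
open import Data.Sum using (inj₁; inj₂)
open import Data.Bool using (Bool; true; false; not)
open import Data.Unit using (⊤; tt)
open import Data.Empty using (⊥)
open import Relation.Nullary using (¬_)
open import Relation.Binary.PropositionalEquality using (_≡_; refl; sym; trans)
open Defs.Axioms SiLlStGrphs using (L1; L2; L3; L4; L5; L6; IsTerminal; IsInitial)
open Graph
open StrictMorphism
open SiLlGraph using (graph; loopless)

IsLoop : (G : Graph) → Edg G → Set
IsLoop G e = proj₁ (ends G e) ≡ proj₂ (ends G e)

identifies-ends⇒loop : ∀ {G H} (f : StrictMorphism G H) (e : Edg G) →
  fV f (proj₁ (ends G e)) ≡ fV f (proj₂ (ends G e)) → IsLoop H (fE f e)
identifies-ends⇒loop f e same with incidence f e
... | inj₁ (p , q) = trans p (trans same (sym q))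
... | inj₂ (p , q) = trans p (trans (sym same) (sym q))

K₁ : SiLlGraph
K₁ = record
  { graph    = record { Vtx = ⊤ ; Edg = ⊥ ; ends = λ () }
  ; simple   = λ ()
  ; loopless = λ ()
  }

K₂ : SiLlGraph
K₂ = record
  { graph    = record { Vtx = Bool ; Edg = ⊤ ; ends = λ _ → false , true }
  ; simple   = λ _ _ _ → refl
  ; loopless = λ _ ()
  }

swap : StrictMorphism (graph K₂) (graph K₂)
swap = record { fV = not ; fE = λ e → e ; incidence = λ _ → inj₂ (refl , refl) }

¬IsTerminal : ∀ T → ¬ IsTerminal T
¬IsTerminal T terminal = loopless T (fE ! tt) (identifies-ends⇒loop ! tt ends-identified)
  where
  ! : StrictMorphism (graph K₂) (graph T)
  ! = proj₁ (terminal K₂)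

  ends-identified : fV ! false ≡ fV ! true
  ends-identified = sym (proj₁ (proj₂ (terminal K₂) (_∘ᴳ_ {graph K₂} ! swap)) false)

¬IsInitial-of-vertex : ∀ G → Vtx (graph G) → ¬ IsInitial G
¬IsInitial-of-vertex G v initial = fV (proj₁ (initial ∅)) v
  where
  ∅ : SiLlGraph
  ∅ = record
    { graph    = record { Vtx = ⊥ ; Edg = ⊥ ; ends = λ () }
    ; simple   = λ ()
    ; loopless = λ ()
    }

proposition3p5 : ¬ L1 × ¬ L2 × ¬ L3 × ¬ L4 × ¬ L5 × ¬ L6
proposition3p5 =
    (λ { (((T , terminal) , _) , _) → ¬IsTerminal T terminal })
  , (λ { ((T , terminal) , _) → ¬IsTerminal T terminal })
  , (λ { (T , terminal , _) → ¬IsTerminal T terminal })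
  , (λ { (T , terminal , _) → ¬IsTerminal T terminal })
  , (λ l5 → fE (proj₁ (l5 {K₁} {K₂} vertex (¬IsInitial-of-vertex K₁ tt))) tt)
  , (λ { (T , terminal , _) → ¬IsTerminal T terminal })
  where
  vertex : StrictMorphism (graph K₁) (graph K₂)
  vertex = record { fV = λ _ → false ; fE = λ () ; incidence = λ () }
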